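{- Let $G$ be a strongly connected digraph of order $p\geq 4$ such that $d(x)+d(y)\geq 2p-1$ for every pair of non-adjacent vertices $x,y$ of $G$. Then $G$ contains a $D(p,3)$, i.e., there exist distinct vertices $u,w,v$ such that $uw,wv\in E(G)$ and there is a $(u,v)$-path of length $p-2$ in $G$ containing all vertices of $G$ other than $w$.
   Context: Digraphs are finite, without loops and without multiple arcs (a pair of opposite arcs $xy,yx$ is allowed). For a vertex $x$, $d(x)=od(x)+id(x)$ is the sum of its out-degree and in-degree. Two distinct vertices are adjacent if at least one of the arcs $xy$, $yx$ is present. Paths are simple and directed. $D(p,3)$ denotes the digraph of order $p$ consisting of two internally disjoint paths from a vertex $u$ to a vertex $v$, one of length $2$ and one of length $p-2$, covering all $p$ vertices. -}

module Defs where

open import Data.Nat using (ℕ; zero; suc; _+_)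
open import Data.Bool using (Bool; true; false; if_then_else_)
open import Data.Fin using (Fin; zero; suc; fromℕ; inject₁)
open import Data.Product using (Σ; _×_; ∃)
open import Data.Sum using (_⊎_)
open import Relation.Binary.PropositionalEquality using (_≡_)
open import Function.Definitions using (Injective)

record Digraph (p : ℕ) : Set where
  field
    arc     : Fin p → Fin p → Bool
    loopless : ∀ x → arc x x ≡ false
open Digraph public

count : ∀ {n} → (Fin n → Bool) → ℕ
count {zero}  f = 0
count {suc n} f = (if f zero then 1 else 0) + count (λ i → f (suc i))

outdeg indeg deg : ∀ {p} → Digraph p → Fin p → ℕ
outdeg G x = count (λ y → arc G x y)
indeg  G x = count (λ y → arc G y x)
deg    G x = outdeg G x + indeg G x

Arc : ∀ {p} → Digraph p → Fin p → Fin p → Set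
Arc G x y = arc G x y ≡ true

Adjacent : ∀ {p} → Digraph p → Fin p → Fin p → Set
Adjacent G x y = Arc G x y ⊎ Arc G y x

record Path {p : ℕ} (G : Digraph p) (k : ℕ) (u v : Fin p) : Set where
  field
    vtx      : Fin (suc k) → Fin p
    distinct : Injective _≡_ _≡_ vtx
    start    : vtx zero ≡ u
    end      : vtx (fromℕ k) ≡ v
    arcs     : ∀ (i : Fin k) → Arc G (vtx (inject₁ i)) (vtx (suc i))
open Path public

OnPath : ∀ {p} {G : Digraph p} {k u v} → Path G k u v → Fin p → Set
OnPath {k = k} P z = ∃ λ (i : Fin (suc k)) → vtx P i ≡ z

StronglyConnected : ∀ {p} → Digraph p → Set
StronglyConnected {p} G = ∀ (x y : Fin p) → ∃ λ k → Path G k x y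

module Submission where

{-
Reversing all arcs at a vertex w changes neither degrees nor adjacency, and a Hamiltonian cycle
v → w → u ⇝ v of the reversed digraph is in G a pair of arcs u → w → v together with a path u ⇝ v
through all the other vertices. So by Meyniel's theorem it is enough to find w whose reversal is
strongly connected.

Meyniel's theorem is proved after Bondy and Thomassen. Over a longest cycle take an ear with the
shortest possible gap R (the cycle may be met in a single vertex), and let x be its first inner
vertex. Inserting vertices of R into the rest of the cycle gets stuck at some y, since otherwise
the ear would give a longer cycle; then x and y are non-adjacent with degree sum at most 2p - 2.

If every reversal fails to be strongly connected, then each w cuts G: there is a fragment, a set
whose arcs to the outside all end in w. By uncrossing, a minimal fragment consists of one vertex,
which then has out-degree or in-degree one; so there is such a low vertex on either side of each
cut. Two low vertices are adjacent by the degree condition. Three of them exist, hence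
(up to reversing all arcs) two of out-degree one, and following their arcs gives a low triangle
y → y′ → l → y. A cut at a fourth vertex leaves the triangle on one side, and the low vertex on
the other side is adjacent to it by an impossible arc.
-}

open import Defs
open import Data.Bool using (Bool; true; false; if_then_else_; _∨_)
open import Data.Bool.Properties using () renaming (_≟_ to _≟ᵇ_)
open import Data.Empty using (⊥; ⊥-elim)
open import Data.Fin using (Fin; zero; suc; _≟_; fromℕ; inject₁)
open import Data.Fin.Properties using (any?; all?)
open import Data.Fin.Subset using (Subset) renaming (_∈_ to _∈ₛ_)
open import Data.Fin.Subset.Properties using (anySubset?) renaming (_∈?_ to _∈ₛ?_)
open import Data.List using (List; []; _∷_; _++_; [_]; map; length; allFin; tabulate; lookup)
open import Data.List.Membership.Propositional using (_∈_; _∉_)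
open import Data.List.Membership.Propositional.Properties using (∈-++⁺ˡ; ∈-++⁺ʳ; ∈-++⁻; ∈-∃++; ∈-allFin; ∈-lookup)
open import Data.List.Properties using (length-++; length-tabulate; map-++; map-cong; map-tabulate; ++-assoc; ++-identityʳ)
open import Data.List.Relation.Binary.Permutation.Propositional using (_↭_; refl; prep; swap; ↭-sym; ↭-trans; ↭-reflexive; ↭⇒↭ₛ)
open import Data.List.Relation.Binary.Permutation.Propositional.Properties using (∈-resp-↭; ↭-length; shift; map⁺; ++-comm) renaming (++⁺ʳ to ↭-++ʳ; ++⁺ˡ to ↭-++ˡ)
import Data.List.Relation.Binary.Permutation.Setoid.Properties as Permutationₛ
open import Data.List.Relation.Unary.All as All using ([]; _∷_)
open import Data.List.Relation.Unary.All.Properties using (¬Any⇒All¬; ++⁻ˡ)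
open import Data.List.Relation.Unary.AllPairs using ([]; _∷_)
open import Data.List.Relation.Unary.Any using (here; there; index)
open import Data.List.Relation.Unary.Any.Properties using (lookup-index)
open import Data.List.Relation.Unary.Unique.Propositional using (Unique)
open import Data.List.Relation.Unary.Unique.Propositional.Properties using (allFin⁺) renaming (++⁺ to Unique-++⁺; Unique[x∷xs]⇒x∉xs to Unique-∉)
open import Data.Nat using (ℕ; zero; suc; _+_; _*_; _∸_; _≤_; _<_; z≤n; s≤s)
open import Data.Nat.ListAction using (sum)
open import Data.Nat.ListAction.Properties using (sum-++; sum-↭)
open import Data.Nat.Properties hiding (_≟_)
open import Data.Nat.Tactic.RingSolver using (solve-∀)
open import Data.Product using (Σ; _×_; _,_; ∃; ∃₂; proj₁; proj₂)
open import Data.Sum using (_⊎_; inj₁; inj₂; [_,_]′) renaming (swap to ⊎-swap)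
import Data.Vec as Vec
open import Data.Vec.Properties using (lookup∘tabulate; lookup⇒[]=; []=⇒lookup)
open import Function using (_∘_; case_of_)
open import Level using (0ℓ)
open import Relation.Binary.PropositionalEquality using (_≡_; _≢_; refl; sym; trans; cong; cong₂; subst; setoid; module ≡-Reasoning)
open import Relation.Nullary using (¬_; Dec; yes; no; does; ¬?; _×-dec_; _⊎-dec_; _→-dec_)
open import Relation.Nullary.Decidable using (dec-true; decidable-stable)
open import Relation.Unary using (Pred; Decidable)

-- Sums over lists and duplicate-free lists

module _ {A : Set} where

  ∑ : (A → ℕ) → List A → ℕ
  ∑ f xs = sum (map f xs)

  ∑-++ : ∀ f xs ys → ∑ f (xs ++ ys) ≡ ∑ f xs + ∑ f ys
  ∑-++ f xs ys = trans (cong sum (map-++ f xs ys)) (sum-++ (map f xs) (map f ys))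

  ∑-↭ : ∀ f {xs ys} → xs ↭ ys → ∑ f xs ≡ ∑ f ys
  ∑-↭ f p = sum-↭ (map⁺ f p)

  ∑-+ : ∀ f g xs → ∑ (λ v → f v + g v) xs ≡ ∑ f xs + ∑ g xs
  ∑-+ f g []       = refl
  ∑-+ f g (x ∷ xs) = trans (cong (f x + g x +_) (∑-+ f g xs)) (interchange (f x) (g x) (∑ f xs) (∑ g xs))
    where
    interchange : ∀ a b c d → a + b + (c + d) ≡ a + c + (b + d)
    interchange = solve-∀

  ∑-bound : ∀ f c xs → (∀ {v} → v ∈ xs → f v ≤ c) → ∑ f xs ≤ length xs * c
  ∑-bound f c []       h = z≤n
  ∑-bound f c (x ∷ xs) h = +-mono-≤ (h (here refl)) (∑-bound f c xs (h ∘ there))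

  Unique-resp-↭ : {xs ys : List A} → xs ↭ ys → Unique xs → Unique ys
  Unique-resp-↭ p = Permutationₛ.Unique-resp-↭ (setoid A) (↭⇒↭ₛ p)

  Unique-disjoint : ∀ xs {ys} {v : A} → Unique (xs ++ ys) → v ∈ xs → v ∉ ys
  Unique-disjoint (x ∷ xs) (x∉ ∷ u) (here refl) v∈ys = All.lookup x∉ (∈-++⁺ʳ xs v∈ys) refl
  Unique-disjoint (x ∷ xs) (_ ∷ u)  (there v∈)  v∈ys = Unique-disjoint xs u v∈ v∈ys

  Unique-++⁻ʳ : ∀ xs {ys : List A} → Unique (xs ++ ys) → Unique ys
  Unique-++⁻ʳ []       u       = u
  Unique-++⁻ʳ (x ∷ xs) (_ ∷ u) = Unique-++⁻ʳ xs u

  ∉-Unique : ∀ {x : A} {xs} → x ∉ xs → Unique xs → Unique (x ∷ xs)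
  ∉-Unique x∉ u = ¬Any⇒All¬ _ x∉ ∷ u

  Unique-++⁻ˡ : ∀ (xs : List A) {ys} → Unique (xs ++ ys) → Unique xs
  Unique-++⁻ˡ []       u         = []
  Unique-++⁻ˡ (x ∷ xs) (x≢ ∷ u) = ++⁻ˡ xs x≢ ∷ Unique-++⁻ˡ xs u

  ∈-remove : ∀ {b v : A} as {bs} → v ∈ as ++ b ∷ bs → v ≢ b → v ∈ as ++ bs
  ∈-remove as v∈ v≢b with ∈-++⁻ as v∈
  ... | inj₁ v∈as         = ∈-++⁺ˡ v∈as
  ... | inj₂ (here v≡b)   = ⊥-elim (v≢b v≡b)
  ... | inj₂ (there v∈bs) = ∈-++⁺ʳ as v∈bs

  Unique-⊆-length : ∀ {xs ys : List A} → Unique xs → (∀ {v} → v ∈ xs → v ∈ ys) → length xs ≤ length ys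
  Unique-⊆-length {xs = []}     u         xs⊆ys = z≤n
  Unique-⊆-length {xs = x ∷ xs} (x≢ ∷ u) xs⊆ys with ∈-∃++ (xs⊆ys (here refl))
  ... | as , bs , refl = subst (suc (length xs) ≤_) (sym (↭-length (shift x as bs)))
    (s≤s (Unique-⊆-length u λ v∈xs → ∈-remove as (xs⊆ys (there v∈xs)) (All.lookup x≢ v∈xs ∘ sym)))

  lookup-injective : ∀ {xs : List A} → Unique xs → ∀ {i j} → lookup xs i ≡ lookup xs j → i ≡ j
  lookup-injective (_ ∷ u)  {zero}  {zero}  eq = refl
  lookup-injective (x≢ ∷ u) {zero}  {suc j} eq = ⊥-elim (All.lookup x≢ (∈-lookup j) eq)
  lookup-injective (x≢ ∷ u) {suc i} {zero}  eq = ⊥-elim (All.lookup x≢ (∈-lookup i) (sym eq))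
  lookup-injective (_ ∷ u)  {suc i} {suc j} eq = cong suc (lookup-injective u eq)

length-allFin : ∀ p → length (allFin p) ≡ p
length-allFin p = length-tabulate {n = p} (λ i → i)

Unique-length : ∀ {p} {xs : List (Fin p)} → Unique xs → length xs ≤ p
Unique-length {p} {xs} u = subst (length xs ≤_) (length-allFin p) (Unique-⊆-length u λ {v} _ → ∈-allFin v)

-- Every degree count below starts here: with the distinguished vertices listed first, a degree
-- splits into their individual contributions and a uniform bound over `Z`.
complement : ∀ {p} (xs : List (Fin p)) → Unique xs → ∃ λ Z → xs ++ Z ↭ allFin p
complement []       u            = _ , refl
complement (x ∷ xs) (x≢ ∷ u) with complement xs u
... | Z , perm with ∈-++⁻ xs (∈-resp-↭ (↭-sym perm) (∈-allFin x))
...   | inj₁ x∈xs = ⊥-elim (All.lookup x≢ x∈xs refl)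
...   | inj₂ x∈Z with ∈-∃++ x∈Z
...     | Z₁ , Z₂ , refl = Z₁ ++ Z₂ , ↭-trans (↭-sym moved) perm
  where
  moved : xs ++ Z₁ ++ x ∷ Z₂ ↭ x ∷ xs ++ Z₁ ++ Z₂
  moved = ↭-trans (↭-++ˡ xs (shift x Z₁ Z₂)) (shift x xs (Z₁ ++ Z₂))

bit : Bool → ℕ
bit b = if b then 1 else 0

bit≤1 : ∀ b → bit b ≤ 1
bit≤1 true  = s≤s z≤n
bit≤1 false = z≤n

bit≡0 : ∀ {b} → ¬ (b ≡ true) → bit b ≡ 0
bit≡0 {true}  h = ⊥-elim (h refl)
bit≡0 {false} h = refl

-- Typically applied to the two arcs of a path of length two that is known to be absent.
exclusive : ∀ a b → ¬ (a ≡ true × b ≡ true) → bit a + bit b ≤ 1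
exclusive true  true  h = ⊥-elim (h (refl , refl))
exclusive true  false h = ≤-refl
exclusive false b     h = bit≤1 b

count≡∑ : ∀ {n} (f : Fin n → Bool) → count f ≡ ∑ (bit ∘ f) (allFin n)
count≡∑ {n} f = trans (go f) (sym (cong sum (map-tabulate {n = n} (λ i → i) (bit ∘ f))))
  where
  go : ∀ {n} (f : Fin n → Bool) → count f ≡ sum (tabulate (bit ∘ f))
  go {zero}  f = refl
  go {suc n} f = cong (bit (f zero) +_) (go (f ∘ suc))

-- Degrees, walks and insertion

module _ {p : ℕ} (G : Digraph p) where

  arc? : ∀ x y → Dec (Arc G x y)
  arc? x y = arc G x y ≟ᵇ true

  no-loop : ∀ {x} → ¬ Arc G x x
  no-loop {x} a with trans (sym a) (loopless G x)
  ... | ()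

  arcs-between : Fin p → Fin p → ℕ
  arcs-between x v = bit (arc G x v) + bit (arc G v x)

  arcs-between≤2 : ∀ x v → arcs-between x v ≤ 2
  arcs-between≤2 x v = +-mono-≤ (bit≤1 (arc G x v)) (bit≤1 (arc G v x))

  nonadjacent⇒0 : ∀ {x v} → ¬ Adjacent G x v → arcs-between x v ≡ 0
  nonadjacent⇒0 h = cong₂ _+_ (bit≡0 (h ∘ inj₁)) (bit≡0 (h ∘ inj₂))

  self⇒0 : ∀ x → arcs-between x x ≡ 0
  self⇒0 x = nonadjacent⇒0 λ { (inj₁ a) → no-loop a ; (inj₂ a) → no-loop a }

  deg≡∑ : ∀ x → deg G x ≡ ∑ (arcs-between x) (allFin p)
  deg≡∑ x = trans (cong₂ _+_ (count≡∑ (λ y → arc G x y)) (count≡∑ (λ y → arc G y x)))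
                  (sym (∑-+ (λ y → bit (arc G x y)) (λ y → bit (arc G y x)) (allFin p)))

  deg-via : ∀ x {xs} → xs ↭ allFin p → deg G x ≡ ∑ (arcs-between x) xs
  deg-via x perm = trans (deg≡∑ x) (sym (∑-↭ (arcs-between x) perm))

  Meyniel : Set
  Meyniel = ∀ x y → x ≢ y → ¬ Adjacent G x y → 2 * p ∸ 1 ≤ deg G x + deg G y

  data Walk : Fin p → List (Fin p) → Fin p → Set where
    stop : ∀ a → Walk a [ a ] a
    _∷_  : ∀ {a b xs c} → Arc G a b → Walk b xs c → Walk a (a ∷ xs) c

  -- The list holds only the vertices strictly between the two ends.
  Chain : Fin p → List (Fin p) → Fin p → Set
  Chain a []       b = Arc G a b
  Chain a (x ∷ xs) b = Arc G a x × Chain x xs b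

  chain-++ : ∀ xs {a y ys b} → Chain a xs y → Chain y ys b → Chain a (xs ++ y ∷ ys) b
  chain-++ []       c       d = c , d
  chain-++ (x ∷ xs) (a , c) d = a , chain-++ xs c d

  chain-split : ∀ xs {a y ys b} → Chain a (xs ++ y ∷ ys) b → Chain a xs y × Chain y ys b
  chain-split []       c       = c
  chain-split (x ∷ xs) (a , c) = let d , e = chain-split xs c in (a , d) , e

  chain-walk : ∀ xs {a b S c} → Chain a xs b → Walk b S c → Walk a (a ∷ xs ++ S) c
  chain-walk []       a       w = a ∷ w
  chain-walk (x ∷ xs) (a , c) w = a ∷ chain-walk xs c w

  walk-arc : ∀ {a S b c} → Walk a S b → Arc G b c → Walk a (S ++ [ c ]) c
  walk-arc (stop a) d = d ∷ stop _
  walk-arc (a ∷ w)  d = a ∷ walk-arc w d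

  walk-chain : ∀ {a S b} xs {c} → Walk a S b → Chain b xs c → Walk a (S ++ xs ++ [ c ]) c
  walk-chain [] w d = walk-arc w d
  walk-chain {S = S} (x ∷ xs) {c} w (d , e) =
    subst (λ T → Walk _ T c) (++-assoc S [ x ] (xs ++ [ c ])) (walk-chain xs (walk-arc w d) e)

  close : ∀ {v S u X w} → Walk v S u → Chain u X w → ∃ λ T → S ++ X ≡ v ∷ T × Chain v T w
  close (stop _) c = _ , refl , c
  close (a ∷ w)  c with close w c
  ... | T , eq , d = _ , cong (_ ∷_) eq , (a , d)

  chain⇒walk : ∀ xs {a b} → Chain a xs b → ∃ λ c → Walk a (a ∷ xs) c × Arc G c b
  chain⇒walk []       c       = _ , stop _ , c
  chain⇒walk (x ∷ xs) (a , c) = let e , w , d = chain⇒walk xs c in e , a ∷ w , d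

  -- The sharper bound, with bit (arc x a) instead of 1, is what makes the induction go through.
  insert-or-sharp : ∀ x {a S b} → Walk a S b →
    (∃ λ S′ → Walk a S′ b × S′ ↭ x ∷ S) ⊎ (∑ (arcs-between x) S ≤ bit (arc G x a) + length S)
  insert-or-sharp x (stop a) = inj₂ (begin
      bit (arc G x a) + bit (arc G a x) + 0  ≡⟨ +-identityʳ _ ⟩
      bit (arc G x a) + bit (arc G a x)      ≤⟨ +-monoʳ-≤ _ (bit≤1 (arc G a x)) ⟩
      bit (arc G x a) + 1                    ∎)
    where open ≤-Reasoning
  insert-or-sharp x (_∷_ {a} {b} {S} a→b w) with insert-or-sharp x w
  ... | inj₁ (S′ , w′ , perm) = inj₁ (a ∷ S′ , extend S′ w′ perm)
    where
    extend : ∀ S′ → Walk b S′ _ → S′ ↭ x ∷ S → Walk a (a ∷ S′) _ × a ∷ S′ ↭ x ∷ a ∷ S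
    extend S′ w′ perm = a→b ∷ w′ , ↭-trans (prep a perm) (swap a x refl)
  ... | inj₂ bound with arc? a x ×-dec arc? x b
  ...   | yes (a→x , x→b) = inj₁ (a ∷ x ∷ S , a→x ∷ x→b ∷ w , swap a x refl)
  ...   | no ¬between     = inj₂ (begin
      arcs-between x a + ∑ (arcs-between x) S
        ≤⟨ +-monoʳ-≤ (arcs-between x a) bound ⟩
      arcs-between x a + (bit (arc G x b) + length S)
        ≡⟨ rearrange (bit (arc G x a)) (bit (arc G a x)) (bit (arc G x b)) (length S) ⟩
      bit (arc G x a) + ((bit (arc G a x) + bit (arc G x b)) + length S)
        ≤⟨ +-monoʳ-≤ (bit (arc G x a)) (+-monoˡ-≤ (length S) (exclusive (arc G a x) (arc G x b) ¬between)) ⟩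
      bit (arc G x a) + suc (length S) ∎)
    where
    open ≤-Reasoning
    rearrange : ∀ i j k l → i + j + (k + l) ≡ i + ((j + k) + l)
    rearrange = solve-∀

  insert-or-bound : ∀ x {a S b} → Walk a S b →
    (∃ λ S′ → Walk a S′ b × S′ ↭ x ∷ S) ⊎ (∑ (arcs-between x) S ≤ suc (length S))
  insert-or-bound x {a} w with insert-or-sharp x w
  ... | inj₁ inserted = inj₁ inserted
  ... | inj₂ bound    = inj₂ (≤-trans bound (+-monoˡ-≤ _ (bit≤1 (arc G x a))))

  -- The vertices of `L` are inserted one at a time. The first that does not fit is `y`; by then the
  -- walk has absorbed the vertices before `y` and become `Q′`, and `L′` is what follows `y` in `L`.
  insert-all-or-stuck : ∀ L {v Q u} → Walk v Q u →
    (∃ λ Q′ → Walk v Q′ u × Q′ ↭ Q ++ L) ⊎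
    (∃ λ Q′ → ∃₂ λ y L′ → Q′ ++ y ∷ L′ ↭ Q ++ L × y ∈ L × suc (length L′) ≤ length L ×
      ∑ (arcs-between y) Q′ ≤ suc (length Q′))
  insert-all-or-stuck []      {Q = Q} w = inj₁ (Q , w , ↭-reflexive (sym (++-identityʳ Q)))
  insert-all-or-stuck (y ∷ L) {Q = Q} w with insert-or-bound y w
  ... | inj₂ bound = inj₂ (Q , y , L , refl , here refl , ≤-refl , bound)
  ... | inj₁ (Q₁ , w₁ , perm₁) with insert-all-or-stuck L w₁
  ...   | inj₁ (Q′ , w′ , perm) =
          inj₁ (Q′ , w′ , ↭-trans perm (↭-trans (↭-++ʳ L perm₁) (↭-sym (shift y Q L))))
  ...   | inj₂ (Q′ , z , L′ , perm , z∈L , short , bound) =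
          inj₂ (Q′ , z , L′ , ↭-trans perm (↭-trans (↭-++ʳ L perm₁) (↭-sym (shift y Q L)))
               , there z∈L , m≤n⇒m≤1+n short , bound)

-- Meyniel's theorem

module _ {p : ℕ} where
  open import Data.List.Membership.DecPropositional (_≟_ {p}) using (_∈?_) public

module _ {p : ℕ} (G : Digraph p) where

  LongerCycle : ℕ → Set
  LongerCycle n = ∃₂ λ a T → Chain G a T a × Unique (a ∷ T) × n < length (a ∷ T)

  closes : ∀ {n v S u X} → Walk G v S u → Chain G u X v → Unique S → Unique X →
    (∀ {z} → z ∈ S → z ∉ X) → n < length (S ++ X) → LongerCycle n
  closes w c uS uX disjoint n< with close G w c
  ... | T , eq , d = _ , T , d
      , subst Unique eq (Unique-++⁺ uS uX λ (z∈S , z∈X) → disjoint z∈S z∈X)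
      , subst (λ U → _ < length U) eq n<

  -- With lower-case letters for lengths: `x` has at most `s + 1` arcs with `S` and none with `R`;
  -- `y` has at most `q + 1` with `Q` and `2l` with `L`; a vertex of `Z` has at most 2 with `x` and
  -- `y` together. As `q + l + 1 = s + r` and `l + 1 ≤ r`, the degree sum is at most
  -- `2(s + r + z) = 2p - 2`.
  no-stuck-pair : Meyniel G → ∀ S R {x y} Q L →
    Unique (S ++ R) → x ∉ S ++ R → y ∈ R → Q ++ y ∷ L ↭ S ++ R → suc (length L) ≤ length R →
    ∑ (arcs-between G x) S ≤ suc (length S) → ∑ (arcs-between G y) Q ≤ suc (length Q) →
    (∀ {r} → r ∈ R → ¬ Adjacent G x r) →
    (∀ {z} → z ∉ S ++ R → z ≢ x → arcs-between G x z + arcs-between G y z ≤ 2) → ⊥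
  no-stuck-pair mey S R {x} {y} Q L uSR x∉ y∈R QL↭SR short boundx boundy nonadj outside
    with complement (x ∷ S ++ R) (∉-Unique x∉ uSR)
  ... | Z , all-vertices = <⇒≱ too-small (mey x y x≢y (nonadj y∈R))
    where
    dx dy : Fin p → ℕ
    dx = arcs-between G x
    dy = arcs-between G y

    x≢y : x ≢ y
    x≢y refl = x∉ (∈-++⁺ʳ S y∈R)

    Z-outside : ∀ {z} → z ∈ Z → z ∉ x ∷ S ++ R
    Z-outside z∈Z z∈ =
      Unique-disjoint (x ∷ S ++ R) (Unique-resp-↭ (↭-sym all-vertices) (allFin⁺ p)) z∈ z∈Z

    in-Z : ∑ dx Z + ∑ dy Z ≤ length Z * 2
    in-Z = subst (_≤ length Z * 2) (∑-+ dx dy Z)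
      (∑-bound (λ z → dx z + dy z) 2 Z λ z∈Z → outside (Z-outside z∈Z ∘ there) (λ { refl → Z-outside z∈Z (here refl) }))

    in-R : ∑ dx R ≤ 0
    in-R = subst (∑ dx R ≤_) (*-zeroʳ (length R))
      (∑-bound dx 0 R λ r∈R → ≤-reflexive (nonadjacent⇒0 G (nonadj r∈R)))

    degx : deg G x ≤ suc (length S) + ∑ dx Z
    degx = begin
      deg G x                               ≡⟨ deg-via G x all-vertices ⟩
      dx x + ∑ dx ((S ++ R) ++ Z)           ≡⟨ cong (_+ ∑ dx ((S ++ R) ++ Z)) (self⇒0 G x) ⟩
      ∑ dx ((S ++ R) ++ Z)                  ≡⟨ ∑-++ dx (S ++ R) Z ⟩
      ∑ dx (S ++ R) + ∑ dx Z                ≡⟨ cong (_+ ∑ dx Z) (∑-++ dx S R) ⟩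
      ∑ dx S + ∑ dx R + ∑ dx Z              ≤⟨ +-monoˡ-≤ (∑ dx Z) (+-mono-≤ boundx in-R) ⟩
      suc (length S) + 0 + ∑ dx Z           ≡⟨ cong (_+ ∑ dx Z) (+-identityʳ _) ⟩
      suc (length S) + ∑ dx Z               ∎
      where open ≤-Reasoning

    dyx : dy x ≡ 0
    dyx = nonadjacent⇒0 G λ { (inj₁ a) → nonadj y∈R (inj₂ a) ; (inj₂ a) → nonadj y∈R (inj₁ a) }

    degy : deg G y ≤ suc (length Q) + length L * 2 + ∑ dy Z
    degy = begin
      deg G y                               ≡⟨ deg-via G y all-vertices ⟩
      dy x + ∑ dy ((S ++ R) ++ Z)           ≡⟨ cong (_+ ∑ dy ((S ++ R) ++ Z)) dyx ⟩
      ∑ dy ((S ++ R) ++ Z)                  ≡⟨ ∑-++ dy (S ++ R) Z ⟩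
      ∑ dy (S ++ R) + ∑ dy Z                ≡⟨ cong (_+ ∑ dy Z) (sym (∑-↭ dy QL↭SR)) ⟩
      ∑ dy (Q ++ y ∷ L) + ∑ dy Z            ≡⟨ cong (_+ ∑ dy Z) (∑-++ dy Q (y ∷ L)) ⟩
      ∑ dy Q + (dy y + ∑ dy L) + ∑ dy Z     ≡⟨ cong (λ k → ∑ dy Q + (k + ∑ dy L) + ∑ dy Z) (self⇒0 G y) ⟩
      ∑ dy Q + ∑ dy L + ∑ dy Z              ≤⟨ +-monoˡ-≤ (∑ dy Z) (+-mono-≤ boundy
                                                 (∑-bound dy 2 L λ {v} _ → arcs-between≤2 G y v)) ⟩
      suc (length Q) + length L * 2 + ∑ dy Z ∎
      where open ≤-Reasoning

    order : p ≡ suc (length S + length R + length Z)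
    order = begin
      p                                     ≡⟨ sym (length-allFin p) ⟩
      length (allFin p)                     ≡⟨ sym (↭-length all-vertices) ⟩
      suc (length ((S ++ R) ++ Z))          ≡⟨ cong suc (length-++ (S ++ R)) ⟩
      suc (length (S ++ R) + length Z)      ≡⟨ cong (λ k → suc (k + length Z)) (length-++ S) ⟩
      suc (length S + length R + length Z)  ∎
      where open ≡-Reasoning

    sizes : length Q + suc (length L) ≡ length S + length R
    sizes = begin
      length Q + suc (length L)  ≡⟨ sym (length-++ Q) ⟩
      length (Q ++ y ∷ L)        ≡⟨ ↭-length QL↭SR ⟩
      length (S ++ R)            ≡⟨ length-++ S ⟩
      length S + length R        ∎
      where open ≡-Reasoning

    too-small : deg G x + deg G y < 2 * p ∸ 1
    too-small = subst (λ k → deg G x + deg G y < 2 * k ∸ 1) (sym order) (begin-strict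
      deg G x + deg G y
        ≤⟨ +-mono-≤ degx degy ⟩
      suc s + ∑ dx Z + (suc q + l * 2 + ∑ dy Z)
        ≡⟨ collect s q l (∑ dx Z) (∑ dy Z) ⟩
      s + (q + suc l) + suc l + (∑ dx Z + ∑ dy Z)
        ≤⟨ +-mono-≤ (+-mono-≤ (≤-reflexive (cong (s +_) sizes)) short) in-Z ⟩
      s + (s + r) + r + z * 2
        <⟨ n<1+n _ ⟩
      suc (s + (s + r) + r + z * 2)
        ≡⟨ double s r z ⟩
      2 * suc (s + r + z) ∸ 1 ∎)
      where
      open ≤-Reasoning
      s r q l z : ℕ
      s = length S ; r = length R ; q = length Q ; l = length L ; z = length Z
      collect : ∀ s q l a b → suc s + a + (suc q + l * 2 + b) ≡ s + (q + suc l) + suc l + (a + b)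
      collect = solve-∀
      double : ∀ s r z → suc (s + (s + r) + r + z * 2) ≡ s + r + z + suc (s + r + z + 0)
      double = solve-∀

  -- S followed by the gap R is a cycle and x ∷ X an ear over the gap, possibly a closed one (u ≡ v).
  -- Without a longer cycle the gap could be shortened, unless x and some y in R have degrees
  -- that contradict the hypothesis.
  extend-cycle : Meyniel G → ∀ n S R x X {u v} → length R ≤ n → Walk G v S u →
    R ≡ [] ⊎ Chain G u R v → Chain G u (x ∷ X) v → Unique (S ++ R) → Unique (x ∷ X) →
    (∀ {z} → z ∈ x ∷ X → z ∉ S ++ R) → LongerCycle (length (S ++ R))
  extend-cycle mey n S [] x X _ w _ ear uSR uX away =
    closes w ear (Unique-++⁻ˡ S uSR) uX (λ z∈S z∈X → away z∈X (∈-++⁺ˡ z∈S))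
      (subst (λ U → length U < length (S ++ x ∷ X)) (sym (++-identityʳ S))
        (subst (length S <_) (sym (length-++ S)) (m<m+n (length S) (s≤s z≤n))))
  extend-cycle mey (suc n) S R@(r₀ ∷ R₀) x X {u} {v} (s≤s R₀≤n) w (inj₂ gap) (u→x , x⇝v) uSR uX away
    = by-cases
    where
    uS : Unique S
    uS = Unique-++⁻ˡ S uSR

    uR : Unique R
    uR = Unique-++⁻ʳ S uSR

    x∉ : x ∉ S ++ R
    x∉ = away (here refl)

    -- For an ear ending inside the gap, at `y`, the part of the gap from `y` on joins `S`, and the
    -- part `R₁` before `y` is the new, strictly shorter gap.
    shorten-right : ∀ {y} x′ X′ → y ∈ R → Chain G u (x′ ∷ X′) y → Unique (x′ ∷ X′) →
      (∀ {z} → z ∈ x′ ∷ X′ → z ∉ S ++ R) → LongerCycle (length (S ++ R))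
    shorten-right {y} x′ X′ y∈R ear uX′ away′ with ∈-∃++ y∈R
    ... | R₁ , R₂ , R≡ =
      subst LongerCycle (↭-length (↭-sym same))
        (extend-cycle mey n (y ∷ R₂ ++ S) R₁ x′ X′ R₁≤n (chain-walk G R₂ (proj₂ gaps) w)
          (inj₂ (proj₁ gaps)) ear (Unique-resp-↭ same uSR) uX′
          (λ z∈ z∈′ → away′ z∈ (∈-resp-↭ (↭-sym same) z∈′)))
      where
      gaps : Chain G u R₁ y × Chain G y R₂ v
      gaps = chain-split G R₁ (subst (λ U → Chain G u U v) R≡ gap)

      same : S ++ R ↭ (y ∷ R₂ ++ S) ++ R₁
      same = ↭-trans (↭-reflexive (trans (cong (S ++_) R≡) (sym (++-assoc S R₁ (y ∷ R₂)))))
            (↭-trans (++-comm (S ++ R₁) (y ∷ R₂)) (↭-reflexive (sym (++-assoc (y ∷ R₂) S R₁))))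

      R₁≤n : length R₁ ≤ n
      R₁≤n = ≤-pred (≤-trans (subst (suc (length R₁) ≤_)
        (sym (trans (cong length R≡) (trans (length-++ R₁) (+-suc (length R₁) (length R₂)))))
        (s≤s (m≤m+n (length R₁) (length R₂)))) (s≤s R₀≤n))

    -- The mirror image: for an ear starting at `y`, the gap up to `y` joins `S` and `R₂` remains.
    shorten-left : ∀ {y} x′ X′ → y ∈ R → Chain G y (x′ ∷ X′) v → Unique (x′ ∷ X′) →
      (∀ {z} → z ∈ x′ ∷ X′ → z ∉ S ++ R) → LongerCycle (length (S ++ R))
    shorten-left {y} x′ X′ y∈R ear uX′ away′ with ∈-∃++ y∈R
    ... | R₁ , R₂ , R≡ =
      subst LongerCycle (cong length (sym same))
        (extend-cycle mey n (S ++ R₁ ++ [ y ]) R₂ x′ X′ R₂≤n (walk-chain G R₁ w (proj₁ gaps))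
          (inj₂ (proj₂ gaps)) ear (subst Unique same uSR) uX′
          (λ {z} z∈ z∈′ → away′ z∈ (subst (z ∈_) (sym same) z∈′)))
      where
      gaps : Chain G u R₁ y × Chain G y R₂ v
      gaps = chain-split G R₁ (subst (λ U → Chain G u U v) R≡ gap)

      same : S ++ R ≡ (S ++ R₁ ++ [ y ]) ++ R₂
      same = trans (cong (S ++_) (trans R≡ (sym (++-assoc R₁ [ y ] R₂))))
                   (sym (++-assoc S (R₁ ++ [ y ]) R₂))

      R₂≤n : length R₂ ≤ n
      R₂≤n = ≤-pred (≤-trans (subst (suc (length R₂) ≤_)
        (sym (trans (cong length R≡) (length-++ R₁)))
        (m≤n+m (suc (length R₂)) (length R₁))) (s≤s R₀≤n))

    x→R? : Dec (∃ λ r → r ∈ R × Arc G x r)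
    x→R? = any? λ r → (r ∈? R) ×-dec arc? G x r

    R→x? : Dec (∃ λ r → r ∈ R × Arc G r x)
    R→x? = any? λ r → (r ∈? R) ×-dec arc? G r x

    x→z→R? : Dec (∃ λ z → z ∉ S ++ R × z ≢ x × Arc G x z × ∃ λ r → r ∈ R × Arc G z r)
    x→z→R? = any? λ z → ¬? (z ∈? S ++ R) ×-dec ¬? (z ≟ x) ×-dec arc? G x z
               ×-dec any? λ r → (r ∈? R) ×-dec arc? G z r

    R→z→x? : Dec (∃ λ z → z ∉ S ++ R × z ≢ x × Arc G z x × ∃ λ r → r ∈ R × Arc G r z)
    R→z→x? = any? λ z → ¬? (z ∈? S ++ R) ×-dec ¬? (z ≟ x) ×-dec arc? G z x
               ×-dec any? λ r → (r ∈? R) ×-dec arc? G r z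

    single : Unique [ x ]
    single = [] ∷ []

    by-cases : LongerCycle (length (S ++ R))
    by-cases with x→R? | R→x? | x→z→R? | R→z→x?
    ... | yes (r , r∈R , x→r) | _ | _ | _ =
      shorten-right x [] r∈R (u→x , x→r) single (λ { (here refl) → x∉ })
    ... | no _ | yes (r , r∈R , r→x) | _ | _ =
      shorten-left x X r∈R (r→x , x⇝v) uX away
    ... | no _ | no _ | yes (z , z∉ , z≢x , x→z , r , r∈R , z→r) | _ =
      shorten-right x [ z ] r∈R (u→x , x→z , z→r) (((λ { refl → z≢x refl }) ∷ []) ∷ [] ∷ [])
        λ { (here refl) → x∉ ; (there (here refl)) → z∉ }
    ... | no _ | no _ | no _ | yes (z , z∉ , z≢x , z→x , r , r∈R , r→z) with z ∈? X
    ...   | no z∉X = shorten-left z (x ∷ X) r∈R (r→z , z→x , x⇝v)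
              (∉-Unique (λ { (here eq) → z≢x eq ; (there z∈X) → z∉X z∈X }) uX)
              λ { (here refl) → z∉ ; (there z∈) → away z∈ }
    -- Here `z` already lies on the ear, so the new ear enters at `z` and keeps only the part from
    -- there on.
    ...   | yes z∈X with ∈-∃++ z∈X
    ...     | X₁ , X₂ , refl = shorten-left z X₂ r∈R (r→z , proj₂ (chain-split G X₁ x⇝v))
                (Unique-++⁻ʳ (x ∷ X₁) uX) (λ z∈ → away (∈-++⁺ʳ (x ∷ X₁) z∈))
    by-cases | no x↛R | no R↛x | no x↛z↛R | no R↛z↛x
      with insert-or-bound G x w
    -- Once `x` fits into `S`, the old gap closes a cycle with one more vertex.
    ... | inj₁ (S′ , w′ , S′↭) = closes w′ gap (Unique-resp-↭ (↭-sym S′↭) (∉-Unique (x∉ ∘ ∈-++⁺ˡ) uS)) uR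
            (λ z∈S′ z∈R → case ∈-resp-↭ S′↭ z∈S′ of λ
              { (here refl) → x∉ (∈-++⁺ʳ S z∈R) ; (there z∈S) → Unique-disjoint S uSR z∈S z∈R })
            (≤-reflexive (sym (↭-length (↭-++ʳ R S′↭))))
    ... | inj₂ bound with insert-all-or-stuck G R w
    -- Once all of `R` fits into `S`, the ear replaces the gap and adds at least the vertex `x`.
    ...   | inj₁ (Q , w′ , Q↭SR) = closes w′ (u→x , x⇝v) (Unique-resp-↭ (↭-sym Q↭SR) uSR) uX
              (λ z∈Q z∈X → away z∈X (∈-resp-↭ Q↭SR z∈Q))
              (subst (length (S ++ R) <_) (sym (length-++ Q))
                (subst (λ k → k < length Q + suc (length X)) (↭-length Q↭SR)
                  (m<m+n (length Q) (s≤s z≤n))))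
    ...   | inj₂ (Q , y , L , QL↭SR , y∈R , short , boundy) =
      ⊥-elim (no-stuck-pair mey S R Q L uSR x∉ y∈R QL↭SR short bound boundy
        (λ { r∈R (inj₁ a) → x↛R (_ , r∈R , a) ; r∈R (inj₂ a) → R↛x (_ , r∈R , a) })
        outside)
      where
      outside : ∀ {z} → z ∉ S ++ R → z ≢ x → arcs-between G x z + arcs-between G y z ≤ 2
      -- The four possible arcs form the paths `x → z → y` and `y → z → x`, either of which would
      -- have shortened the gap.
      outside {z} z∉ z≢x = subst (_≤ 2) (cross (bit (arc G x z)) (bit (arc G z y)) (bit (arc G y z)) (bit (arc G z x)))
        (+-mono-≤
          (exclusive (arc G x z) (arc G z y) λ (a , b) → x↛z↛R (z , z∉ , z≢x , a , y , y∈R , b))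
          (exclusive (arc G y z) (arc G z x) λ (a , b) → R↛z↛x (z , z∉ , z≢x , b , y , y∈R , a)))
        where
        cross : ∀ a b c d → (a + b) + (c + d) ≡ (a + d) + (c + b)
        cross = solve-∀

-- Ears and the growth of a cycle

module _ {p : ℕ} (G : Digraph p) where

  -- Strong connectivity in terms of cuts. This form passes to the opposite digraph by complementing
  -- `P`, and directly drives both the search for ears and the arguments on closed sets.
  Connected : Set₁
  Connected = ∀ {P : Pred (Fin p) 0ℓ} → Decidable P → ∀ {x y} → P x → ¬ P y →
    ∃₂ λ s t → P s × ¬ P t × Arc G s t

  -- A search outside C: T collects the vertices already reached from x, and k is fuel.
  ear-from : Connected → ∀ C {c} → c ∈ C → ∀ k x T → p < k + length T → Unique T → x ∈ T →
    (∀ {t} → t ∈ T → t ∉ C) →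
    (∀ {t} → t ∈ T → ∃ λ X → Walk G x X t × Unique X × (∀ {z} → z ∈ X → z ∈ T)) →
    ∃₂ λ v X → v ∈ C × Chain G x X v × Unique (x ∷ X) × (∀ {z} → z ∈ x ∷ X → z ∉ C)
  ear-from conn C c∈C zero    x T p<T uT x∈T away walks = ⊥-elim (<⇒≱ p<T (Unique-length uT))
  ear-from conn C c∈C (suc k) x T p<k+T uT x∈T away walks
    with conn (_∈? T) x∈T (λ c∈T → away c∈T c∈C)
  ... | s , t , s∈T , t∉T , s→t with walks s∈T
  ...   | X , w , uX , X⊆T with t ∈? C
  ...     | yes t∈C with close G w s→t
  ...       | X′ , eq , c =
              t , X′ , t∈C , c , subst Unique X≡ uX , λ z∈ → away (X⊆T (subst (_ ∈_) (sym X≡) z∈))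
    where
    X≡ : X ≡ x ∷ X′
    X≡ = trans (sym (++-identityʳ X)) eq
  ear-from conn C c∈C (suc k) x T p<k+T uT x∈T away walks
      | s , t , s∈T , t∉T , s→t | X , w , uX , X⊆T | no t∉C =
    ear-from conn C c∈C k x (t ∷ T) (subst (p <_) (sym (+-suc k (length T))) p<k+T)
      (∉-Unique t∉T uT) (there x∈T)
      (λ { (here refl) → t∉C ; (there t∈) → away t∈ })
      λ { (here refl) → X ++ [ t ] , walk-arc G w s→t
                      , Unique-++⁺ uX ([] ∷ []) (λ { (z∈X , here refl) → t∉T (X⊆T z∈X) })
                      , λ z∈ → case ∈-++⁻ X z∈ of λ { (inj₁ z∈X) → there (X⊆T z∈X) ; (inj₂ (here refl)) → here refl }
        ; (there t∈) → let X₁ , w₁ , u₁ , ⊆₁ = walks t∈ in X₁ , w₁ , u₁ , there ∘ ⊆₁ }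

  ear : Connected → ∀ C {c x} → c ∈ C → x ∉ C →
    ∃₂ λ v X → v ∈ C × Chain G x X v × Unique (x ∷ X) × (∀ {z} → z ∈ x ∷ X → z ∉ C)
  ear conn C {x = x} c∈C x∉C = ear-from conn C c∈C p x [ x ] (m<m+n p (s≤s z≤n)) ([] ∷ []) (here refl)
    (λ { (here refl) → x∉C }) λ { (here refl) → [ x ] , stop x , [] ∷ [] , λ z∈ → z∈ }

  rotate : ∀ {a T s} → Chain G a T a → s ∈ a ∷ T → ∃ λ T′ → Chain G s T′ s × s ∷ T′ ↭ a ∷ T
  rotate {T = T} c (here refl) = T , c , refl
  rotate {a} {s = s} c (there s∈T) with ∈-∃++ s∈T
  ... | T₁ , T₂ , refl = let c₁ , c₂ = chain-split G T₁ c in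
    T₂ ++ a ∷ T₁ , chain-++ G T₂ c₂ c₁ , ++-comm (s ∷ T₂) (a ∷ T₁)

  -- The arc `s → t` followed by a path from `t` back to the cycle, first met at `v`, is an ear. The
  -- gap is the stretch of the cycle strictly between `s` and `v`.
  longer-cycle : Meyniel G → Connected → ∀ {a T s t} → Chain G a T a → Unique (a ∷ T) →
    s ∈ a ∷ T → t ∉ a ∷ T → Arc G s t → LongerCycle G (length (a ∷ T))
  longer-cycle mey conn {a} {T} {s} {t} c uC s∈C t∉C s→t
    with rotate c s∈C | ear conn (a ∷ T) s∈C t∉C
  ... | T′ , c′ , same | v , X , v∈C , t⇝v , uX , away = from (∈-resp-↭ (↭-sym same) v∈C)
    where
    extend : ∀ S R → Walk G v S s → Chain G s R v → S ++ R ↭ s ∷ T′ → LongerCycle G (length (a ∷ T))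
    extend S R w gap perm = subst (LongerCycle G) (↭-length (↭-trans perm same))
      (extend-cycle G mey (length R) S R t X ≤-refl w (inj₂ gap) (s→t , t⇝v)
        (Unique-resp-↭ (↭-sym (↭-trans perm same)) uC) uX
        λ z∈ z∈′ → away z∈ (∈-resp-↭ (↭-trans perm same) z∈′))

    from : v ∈ s ∷ T′ → LongerCycle G (length (a ∷ T))
    -- The ear is closed, returning to `s`: `S` is the single vertex `s` and the gap is the rest of
    -- the cycle.
    from (here refl)  = extend [ s ] T′ (stop s) c′ refl
    from (there v∈T′) with ∈-∃++ v∈T′
    ... | R , S′ , refl = let gap , rest = chain-split G R c′ in
      extend (v ∷ S′ ++ [ s ]) R (chain-walk G S′ rest (stop s)) gap
        (↭-trans (↭-reflexive (cong (v ∷_) (++-assoc S′ [ s ] R)))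
          (↭-trans (shift s (v ∷ S′) R) (prep s (++-comm (v ∷ S′) R))))

  HamiltonianFrom : Fin p → Set
  HamiltonianFrom w = ∃ λ T → Chain G w T w × Unique (w ∷ T) × (∀ z → z ∈ w ∷ T)

  -- Here `k` bounds the extensions still possible, since each lengthens the cycle and no cycle has
  -- more than `p` vertices.
  grow-cycle : Meyniel G → Connected → ∀ k {a T} → p ≤ k + length (a ∷ T) → Chain G a T a →
    Unique (a ∷ T) → ∃ HamiltonianFrom
  grow-cycle mey conn k {a} {T} p≤ c uC with any? (λ z → ¬? (z ∈? a ∷ T))
  ... | no all-in = a , T , c , uC , λ z → decidable-stable (z ∈? a ∷ T) λ z∉ → all-in (z , z∉)
  ... | yes (z , z∉) with conn (_∈? a ∷ T) (here refl) z∉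
  ...   | s , t , s∈ , t∉ , s→t with k | longer-cycle mey conn c uC s∈ t∉ s→t
  ...     | zero   | _ = ⊥-elim (<⇒≱ (Unique-length (∉-Unique z∉ uC)) p≤)
  ...     | suc k′ | b , U , d , uD , longer =
            grow-cycle mey conn k′ (≤-trans p≤ (≤-trans (≤-reflexive (sym (+-suc k′ _))) (+-monoʳ-≤ k′ longer))) d uD

  meyniel : Meyniel G → Connected → ∀ {a b} → a ≢ b → ∀ w → HamiltonianFrom w
  meyniel mey conn {a} {b} a≢b w with conn (_≟ a) refl (λ b≡a → a≢b (sym b≡a))
  -- The first cycle is an arc leaving `a` followed by a path back to `a`.
  ... | .a , t , refl , t≢a , a→t with ear conn [ a ] (here refl) (λ { (here eq) → t≢a eq })
  ...   | .a , X , here refl , t⇝a , uX , away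
    with grow-cycle mey conn p (m≤m+n p _) (a→t , t⇝a) (∉-Unique (λ a∈ → away a∈ (here refl)) uX)
  ...     | d , T , c , u , covers with rotate c (covers w)
  ...       | T′ , c′ , same = T′ , c′ , Unique-resp-↭ (↭-sym same) u , λ z → ∈-resp-↭ (↭-sym same) (covers z)

-- Reversing the arcs at a vertex

opposite : ∀ {p} → Digraph p → Digraph p
opposite G = record { arc = λ x y → arc G y x ; loopless = loopless G }

reverse-at : ∀ {p} → Digraph p → Fin p → Digraph p
reverse-at G w = record
  { arc      = λ x y → if does (x ≟ w) ∨ does (y ≟ w) then arc G y x else arc G x y
  ; loopless = loop
  }
  where
  loop : ∀ x → (if does (x ≟ w) ∨ does (x ≟ w) then arc G x x else arc G x x) ≡ false
  loop x with does (x ≟ w)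
  ... | true  = loopless G x
  ... | false = loopless G x

module _ {p : ℕ} (G : Digraph p) (w : Fin p) where

  reverse-out : ∀ y → arc (reverse-at G w) w y ≡ arc G y w
  reverse-out y with w ≟ w
  ... | yes _   = refl
  ... | no w≢w = ⊥-elim (w≢w refl)

  reverse-in : ∀ y → arc (reverse-at G w) y w ≡ arc G w y
  reverse-in y with y ≟ w | w ≟ w
  ... | yes _ | _       = refl
  ... | no _  | yes _   = refl
  ... | no _  | no w≢w = ⊥-elim (w≢w refl)

  reverse-away : ∀ {x y} → x ≢ w → y ≢ w → arc (reverse-at G w) x y ≡ arc G x y
  reverse-away {x} {y} x≢w y≢w with x ≟ w | y ≟ w
  ... | yes x≡w | _       = ⊥-elim (x≢w x≡w)
  ... | no _    | yes y≡w = ⊥-elim (y≢w y≡w)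
  ... | no _    | no _    = refl

  -- Reversal at most exchanges the two summands; invariance of degrees follows.
  reverse-between : ∀ x v → arcs-between (reverse-at G w) x v ≡ arcs-between G x v
  reverse-between x v with x ≟ w | v ≟ w
  ... | yes _ | yes _ = +-comm (bit (arc G v x)) _
  ... | yes _ | no _  = +-comm (bit (arc G v x)) _
  ... | no _  | yes _ = +-comm (bit (arc G v x)) _
  ... | no _  | no _  = refl

  reverse-deg : ∀ x → deg (reverse-at G w) x ≡ deg G x
  reverse-deg x = trans (deg≡∑ (reverse-at G w) x) (trans (cong sum (map-cong (reverse-between x) (allFin p))) (sym (deg≡∑ G x)))

  reverse-adjacent : ∀ {x y} → Adjacent G x y → Adjacent (reverse-at G w) x y
  reverse-adjacent {x} {y} a with x ≟ w | y ≟ w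
  ... | yes _ | yes _ = ⊎-swap a
  ... | yes _ | no _  = ⊎-swap a
  ... | no _  | yes _ = ⊎-swap a
  ... | no _  | no _  = a

  reverse-Meyniel : Meyniel G → Meyniel (reverse-at G w)
  reverse-Meyniel mey x y x≢y nonadj = subst (2 * p ∸ 1 ≤_)
    (sym (cong₂ _+_ (reverse-deg x) (reverse-deg y))) (mey x y x≢y (nonadj ∘ reverse-adjacent))

-- Closed subsets, opposite digraphs and fragments

module _ {p : ℕ} (G : Digraph p) where

  -- Subset rather than Pred, so that existence is decidable.
  ClosedSubset : Subset p → Set
  ClosedSubset X = (∃ λ x → x ∈ₛ X) × (∃ λ y → ¬ (y ∈ₛ X)) ×
    (∀ x y → x ∈ₛ X → Arc G x y → y ∈ₛ X)

  closedSubset? : Dec (∃ ClosedSubset)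
  closedSubset? = anySubset? λ X →
    any? (_∈ₛ? X) ×-dec any? (λ y → ¬? (y ∈ₛ? X)) ×-dec
    all? λ x → all? λ y → (x ∈ₛ? X) →-dec arc? G x y →-dec (y ∈ₛ? X)

  no-closedSubset⇒Connected : ¬ ∃ ClosedSubset → Connected G
  no-closedSubset⇒Connected none {P} P? {x} {y} Px ¬Py
    with any? (λ s → any? λ t → P? s ×-dec ¬? (P? t) ×-dec arc? G s t)
  ... | yes (s , t , leaving) = s , t , leaving
  ... | no stuck = ⊥-elim (none (X , (x , P⇒∈ Px) , (y , ¬Py ∘ ∈⇒P) ,
      λ s t s∈X s→t → P⇒∈ (decidable-stable (P? t) λ ¬Pt → stuck (s , t , ∈⇒P s∈X , ¬Pt , s→t))))
    where
    X : Subset p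
    X = Vec.tabulate (does ∘ P?)

    P⇒∈ : ∀ {v} → P v → v ∈ₛ X
    P⇒∈ {v} Pv = lookup⇒[]= v X (trans (lookup∘tabulate (does ∘ P?) v) (dec-true (P? v) Pv))

    ∈⇒P : ∀ {v} → v ∈ₛ X → P v
    ∈⇒P {v} v∈X with P? v | trans (sym (lookup∘tabulate (does ∘ P?) v)) ([]=⇒lookup v∈X)
    ... | yes Pv | _ = Pv
    ... | no _   | ()

opposite-Connected : ∀ {p} {G : Digraph p} → Connected G → Connected (opposite G)
opposite-Connected conn P? Px ¬Py with conn (λ v → ¬? (P? v)) ¬Py (λ ¬Px → ¬Px Px)
... | s , t , ¬Ps , ¬¬Pt , s→t = t , s , decidable-stable (P? t) ¬¬Pt , ¬Ps , s→t

opposite-deg : ∀ {p} (G : Digraph p) x → deg (opposite G) x ≡ deg G x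
opposite-deg G x = +-comm (indeg G x) (outdeg G x)

opposite-Meyniel : ∀ {p} {G : Digraph p} → Meyniel G → Meyniel (opposite G)
opposite-Meyniel {p} {G} mey x y x≢y nonadj = subst (2 * p ∸ 1 ≤_)
  (sym (cong₂ _+_ (opposite-deg G x) (opposite-deg G y))) (mey x y x≢y (nonadj ∘ ⊎-swap))

-- A witness that deleting `w` destroys strong connectivity. Requiring a vertex `outside` other than
-- `w` makes the notion symmetric, so that the far side of the cut is a fragment of the opposite
-- digraph.
record Fragment {p : ℕ} (G : Digraph p) (w : Fin p) : Set₁ where
  field
    In        : Pred (Fin p) 0ℓ
    In?       : Decidable In
    cutvertex : ¬ In w
    inside    : ∃ In
    outside   : ∃ λ a → ¬ In a × a ≢ w
    closed    : ∀ {x y} → In x → Arc G x y → In y ⊎ y ≡ w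

-- For a fragment arising from a subset closed in reverse-at G w: w lies outside that subset or in it.
OneWay : ∀ {p} {G : Digraph p} {w} → Fragment G w → Set
OneWay {G = G} {w} F = (∀ {b} → In b → ¬ Arc G w b) ⊎ (∀ {a} → ¬ In a → a ≢ w → ¬ Arc G a w)
  where open Fragment F

dual : ∀ {p} {G : Digraph p} {w} → Fragment G w → Fragment (opposite G) w
dual {p} {G} {w} F = record
  { In        = λ v → ¬ In v × v ≢ w
  ; In?       = λ v → ¬? (In? v) ×-dec ¬? (v ≟ w)
  ; cutvertex = λ (_ , w≢w) → w≢w refl
  ; inside    = outside
  ; outside   = let b , b∈ = inside in b , (λ (b∉ , _) → b∉ b∈) , λ { refl → cutvertex b∈ }
  ; closed    = λ {x} {y} → closed′ {x} {y}
  }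
  where
  open Fragment F
  closed′ : ∀ {x y} → ¬ In x × x ≢ w → Arc G y x → (¬ In y × y ≢ w) ⊎ y ≡ w
  closed′ {x} {y} (x∉ , x≢w) y→x with y ≟ w
  ... | yes y≡w = inj₂ y≡w
  ... | no y≢w  = inj₁ ((λ y∈ → [ x∉ , x≢w ]′ (closed y∈ y→x)) , y≢w)

dual-OneWay : ∀ {p} {G : Digraph p} {w} (F : Fragment G w) → OneWay F → OneWay (dual F)
dual-OneWay F (inj₁ none) = inj₂ λ a∉ a≢w → none (decidable-stable (In? _) λ ¬a → a∉ (¬a , a≢w))
  where open Fragment F
dual-OneWay F (inj₂ none) = inj₁ λ (b∉ , b≢w) → none b∉ b≢w

module _ {p : ℕ} {G : Digraph p} (conn : Connected G) {v w : Fin p} (v≢w : v ≢ w) where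

  out-neighbour : ∃ λ t → t ≢ w × Arc G w t
  out-neighbour with conn (_≟ w) refl v≢w
  ... | .w , t , refl , t≢w , w→t = t , t≢w , w→t

  in-neighbour : ∃ λ s → s ≢ w × Arc G s w
  in-neighbour with conn (λ z → ¬? (z ≟ w)) v≢w (λ w≢w → w≢w refl)
  ... | s , t , s≢w , ¬t≢w , s→t with decidable-stable (t ≟ w) ¬t≢w
  ...   | refl = s , s≢w , s→t

  -- Away from `w` the reversal changes nothing, so `X` without `w` is a fragment. If `w` is not in
  -- `X`, an arc of `G` from `w` into `X` would, reversed, leave `X`; if `w` is in `X`, so would an
  -- arc of `G` from outside `X` to `w`. This gives the two alternatives of `OneWay`.
  closed⇒fragment : ∃ (ClosedSubset (reverse-at G w)) → Σ (Fragment G w) OneWay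
  closed⇒fragment (X , (x , x∈X) , (y , y∉X) , closedX) = F , one-way
    where
    from-w : ∀ {z} → w ∈ₛ X → Arc G z w → z ∈ₛ X
    from-w {z} w∈X z→w = closedX w z w∈X (trans (reverse-out G w z) z→w)

    to-w : ∀ {z} → z ∈ₛ X → Arc G w z → w ∈ₛ X
    to-w {z} z∈X w→z = closedX z w z∈X (trans (reverse-in G w z) w→z)

    inside : ∃ λ z → z ∈ₛ X × z ≢ w
    inside with x ≟ w
    ... | no x≢w   = x , x∈X , x≢w
    -- If the given member of `X` is `w` itself, an in-neighbour `s` of `w` serves: `w → s` is an
    -- arc of the reversal.
    ... | yes refl = let s , s≢w , s→w = in-neighbour in s , from-w x∈X s→w , s≢w

    outside : ∃ λ z → ¬ (z ∈ₛ X × z ≢ w) × z ≢ w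
    outside with y ≟ w
    ... | no y≢w   = y , (λ (y∈X , _) → y∉X y∈X) , y≢w
    ... | yes refl = let t , t≢w , w→t = out-neighbour in t , (λ (t∈X , _) → y∉X (to-w t∈X w→t)) , t≢w

    closed : ∀ {x y} → x ∈ₛ X × x ≢ w → Arc G x y → (y ∈ₛ X × y ≢ w) ⊎ y ≡ w
    closed {x} {y} (x∈X , x≢w) x→y with y ≟ w
    ... | yes y≡w = inj₂ y≡w
    ... | no y≢w  = inj₁ (closedX x y x∈X (trans (reverse-away G w x≢w y≢w) x→y) , y≢w)

    F : Fragment G w
    F = record
      { In        = λ z → z ∈ₛ X × z ≢ w
      ; In?       = λ z → (z ∈ₛ? X) ×-dec ¬? (z ≟ w)
      ; cutvertex = λ (_ , w≢w) → w≢w refl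
      ; inside    = inside
      ; outside   = outside
      ; closed    = λ {x} {y} → closed {x} {y}
      }

    one-way : OneWay F
    one-way with w ∈ₛ? X
    ... | yes w∈X = inj₂ λ a∉ a≢w a→w → a∉ (from-w w∈X a→w , a≢w)
    ... | no w∉X  = inj₁ λ (b∈X , _) w→b → w∉X (to-w b∈X w→b)

-- No vertex can be reversed without destroying strong connectivity.
record Critical {p : ℕ} (G : Digraph p) : Set₁ where
  field
    connected : Connected G
    degrees   : Meyniel G
    fragment  : ∀ w → Fragment G w
    one-way   : ∀ w → OneWay (fragment w)

opposite-Critical : ∀ {p} {G : Digraph p} → Critical G → Critical (opposite G)
opposite-Critical {G = G} crit = record
  { connected = opposite-Connected {G = G} connected
  ; degrees   = opposite-Meyniel {G = G} degrees
  ; fragment  = dual ∘ fragment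
  ; one-way   = λ w → dual-OneWay (fragment w) (one-way w)
  }
  where open Critical crit

-- Vertices of out- or in-degree one

OutDegreeOne Low : ∀ {p} → Digraph p → Fin p → Set
OutDegreeOne G l = ∃ λ w → Arc G l w × (∀ {y} → Arc G l y → y ≡ w)
Low G l = OutDegreeOne G l ⊎ OutDegreeOne (opposite G) l

below-Meyniel : ∀ {a b} p → a < p → b < p → a + b < 2 * p ∸ 1
below-Meyniel {a} {b} p a<p b<p = ∸-monoˡ-≤ 1 (begin
  suc (suc (a + b))  ≡⟨ cong suc (sym (+-suc a b)) ⟩
  suc a + suc b      ≤⟨ +-mono-≤ a<p b<p ⟩
  p + p              ≡⟨ cong (p +_) (sym (+-identityʳ p)) ⟩
  2 * p              ∎)
  where open ≤-Reasoning

-- There is one arc out, and arcs in come from at most `p - 2` vertices, `l` and `m` being excluded.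
outDegreeOne⇒deg< : ∀ {p} (G : Digraph p) {l m} → OutDegreeOne G l → l ≢ m → ¬ Adjacent G l m →
  deg G l < p
outDegreeOne⇒deg< {p} G {l} {m} (w , l→w , only) l≢m nonadj
  with complement (l ∷ m ∷ w ∷ []) unique
  where
  unique : Unique (l ∷ m ∷ w ∷ [])
  unique = (l≢m ∷ (λ { refl → no-loop G l→w }) ∷ []) ∷ ((λ { refl → nonadj (inj₁ l→w) }) ∷ []) ∷ [] ∷ []
... | Z , perm = begin-strict
  deg G l                                 ≡⟨ deg-via G l perm ⟩
  d l + (d m + (d w + ∑ d Z))             ≡⟨ cong₂ (λ i j → i + (j + (d w + ∑ d Z))) (self⇒0 G l) (nonadjacent⇒0 G nonadj) ⟩
  d w + ∑ d Z                             ≤⟨ +-mono-≤ (arcs-between≤2 G l w) (∑-bound d 1 Z in-only) ⟩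
  2 + length Z * 1                        ≡⟨ cong (2 +_) (*-identityʳ (length Z)) ⟩
  2 + length Z                            <⟨ n<1+n _ ⟩
  length (l ∷ m ∷ w ∷ Z)                  ≡⟨ trans (↭-length perm) (length-allFin p) ⟩
  p                                       ∎
  where
  open ≤-Reasoning
  d : Fin p → ℕ
  d = arcs-between G l
  in-only : ∀ {z} → z ∈ Z → d z ≤ 1
  in-only {z} z∈Z = +-mono-≤ (≤-reflexive (bit≡0 {arc G l z} λ l→z →
    Unique-disjoint (l ∷ m ∷ w ∷ []) (Unique-resp-↭ (↭-sym perm) (allFin⁺ p))
      (there (there (here refl))) (subst (_∈ Z) (only l→z) z∈Z))) (bit≤1 (arc G z l))

low⇒deg< : ∀ {p} (G : Digraph p) {l m} → Low G l → l ≢ m → ¬ Adjacent G l m → deg G l < p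
low⇒deg< G (inj₁ out) l≢m nonadj = outDegreeOne⇒deg< G out l≢m nonadj
low⇒deg< {p} G (inj₂ ins) l≢m nonadj =
  subst (_< p) (opposite-deg G _) (outDegreeOne⇒deg< (opposite G) ins l≢m (nonadj ∘ ⊎-swap))

low-adjacent : ∀ {p} (G : Digraph p) → Meyniel G → ∀ {l m} → Low G l → Low G m → l ≢ m → Adjacent G l m
low-adjacent {p} G mey {l} {m} low-l low-m l≢m = decidable-stable (arc? G l m ⊎-dec arc? G m l) λ nonadj →
  <⇒≱ (below-Meyniel p (low⇒deg< G low-l l≢m nonadj) (low⇒deg< G low-m (l≢m ∘ sym) (nonadj ∘ ⊎-swap)))
      (mey l m l≢m nonadj)

-- Uncrossing fragments

-- Only b and w can be joined to {x , y} by three arcs; four arcs at b are excluded by OneWay.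
no-disjoint-fragments : ∀ {p} {G : Digraph p} → Meyniel G → ∀ {w b} (F : Fragment G w) (F′ : Fragment G b) →
  OneWay F′ → Fragment.In F b → ¬ Fragment.In F′ w →
  (∀ {z} → Fragment.In F z → ¬ Fragment.In F′ z) → ∀ {y} → Fragment.In F y → y ≢ b → ⊥
no-disjoint-fragments {p} {G} mey {w} {b} F F′ oneway b∈F w∉F′ disjoint {y} y∈F y≢b
  with Fragment.inside F′
... | x , x∈F′ with complement (x ∷ y ∷ b ∷ w ∷ []) unique
  where
  open Fragment
  unique : Unique (x ∷ y ∷ b ∷ w ∷ [])
  unique = ((λ { refl → disjoint y∈F x∈F′ }) ∷ (λ { refl → cutvertex F′ x∈F′ }) ∷ (λ { refl → w∉F′ x∈F′ }) ∷ [])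
           ∷ (y≢b ∷ (λ { refl → cutvertex F y∈F }) ∷ [])
           ∷ ((λ { refl → cutvertex F b∈F }) ∷ []) ∷ [] ∷ []
...   | Z , perm = <⇒≱ (begin-strict
    deg G x + deg G y
      ≡⟨ cong₂ _+_ (deg-via G x perm) (deg-via G y perm) ⟩
    ∑ dx V + ∑ dy V
      ≡⟨ sym (∑-+ dx dy V) ⟩
    f x + (f y + (f b + (f w + ∑ f Z)))
      ≡⟨ cong₂ (λ i j → i + (j + (f b + (f w + ∑ f Z))))
           (cong₂ _+_ (self⇒0 G x) (nonadjacent⇒0 G (nonadj ∘ ⊎-swap)))
           (cong₂ _+_ (nonadjacent⇒0 G nonadj) (self⇒0 G y)) ⟩
    f b + (f w + ∑ f Z)
      ≤⟨ +-mono-≤ f-b (+-mono-≤ f-w (∑-bound f 2 Z f-Z)) ⟩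
    6 + length Z * 2
      <⟨ n<1+n _ ⟩
    7 + length Z * 2
      ≡⟨ double (length Z) ⟩
    2 * length V ∸ 1
      ≡⟨ cong (λ k → 2 * k ∸ 1) (trans (↭-length perm) (length-allFin p)) ⟩
    2 * p ∸ 1 ∎) (mey x y (λ { refl → disjoint y∈F x∈F′ }) nonadj)
  where
  open ≤-Reasoning
  V : List (Fin p)
  V = x ∷ y ∷ b ∷ w ∷ Z

  dx dy f : Fin p → ℕ
  dx = arcs-between G x
  dy = arcs-between G y
  f v = dx v + dy v

  double : ∀ z → 7 + z * 2 ≡ 3 + (z + (4 + (z + 0)))
  double = solve-∀

  x-out : ∀ {z} → Arc G x z → Fragment.In F′ z ⊎ z ≡ b
  x-out = Fragment.closed F′ x∈F′

  y-out : ∀ {z} → Arc G y z → Fragment.In F z ⊎ z ≡ w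
  y-out = Fragment.closed F y∈F

  nonadj : ¬ Adjacent G x y
  nonadj (inj₁ x→y) = [ disjoint y∈F , y≢b ]′ (x-out x→y)
  nonadj (inj₂ y→x) = [ (λ x∈F → disjoint x∈F x∈F′) , (λ { refl → w∉F′ x∈F′ }) ]′ (y-out y→x)

  -- Grouping by the paths `x → v → y` and `y → v → x` gives at most 2 whenever both are absent. The
  -- total is then at most `3 + 3 + 2(p - 4) = 2p - 2`.
  regroup : ∀ v → (bit (arc G x v) + bit (arc G v y)) + (bit (arc G y v) + bit (arc G v x)) ≡ f v
  regroup v = cross (bit (arc G x v)) (bit (arc G v y)) (bit (arc G y v)) (bit (arc G v x))
    where
    cross : ∀ i j k l → (i + j) + (k + l) ≡ (i + l) + (k + j)
    cross = solve-∀

  bounded : ∀ {i j} v → bit (arc G x v) + bit (arc G v y) ≤ i → bit (arc G y v) + bit (arc G v x) ≤ j → f v ≤ i + j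
  bounded {i} {j} v h k = subst (_≤ i + j) (regroup v) (+-mono-≤ h k)

  -- Either alternative of `OneWay` rules out `y → b → x`: `b` has no arc into `F′`, or nothing
  -- outside `F′` has an arc to `b`.
  f-b : f b ≤ 3
  f-b = bounded b (+-mono-≤ (bit≤1 (arc G x b)) (bit≤1 (arc G b y)))
    (exclusive (arc G y b) (arc G b x) λ (y→b , b→x) → case oneway of λ
      { (inj₁ none) → none x∈F′ b→x ; (inj₂ none) → none (disjoint y∈F) y≢b y→b })

  f-w : f w ≤ 3
  f-w = bounded w
    (exclusive (arc G x w) (arc G w y) λ (x→w , _) → [ w∉F′ , (λ { refl → Fragment.cutvertex F b∈F }) ]′ (x-out x→w))
    (+-mono-≤ (bit≤1 (arc G y w)) (bit≤1 (arc G w x)))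

  f-Z : ∀ {z} → z ∈ Z → f z ≤ 2
  f-Z {z} z∈Z = bounded z
    (exclusive (arc G x z) (arc G z y) λ (x→z , z→y) → case x-out x→z of λ
      { (inj₁ z∈F′) → [ disjoint y∈F , y≢b ]′ (Fragment.closed F′ z∈F′ z→y)
      ; (inj₂ refl) → not-in-Z (there (there (here refl))) })
    (exclusive (arc G y z) (arc G z x) λ (y→z , z→x) → case y-out y→z of λ
      { (inj₁ z∈F)  → [ (λ x∈F → disjoint x∈F x∈F′) , (λ { refl → w∉F′ x∈F′ }) ]′ (Fragment.closed F z∈F z→x)
      ; (inj₂ refl) → not-in-Z (there (there (there (here refl)))) })
    where
    not-in-Z : z ∉ x ∷ y ∷ b ∷ w ∷ []
    not-in-Z z∈ = Unique-disjoint (x ∷ y ∷ b ∷ w ∷ []) (Unique-resp-↭ (↭-sym perm) (allFin⁺ p)) z∈ z∈Z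

-- An arc leaving the intersection cannot end in `w`, which is outside `F′` and different from `b`;
-- so it ends in `b`.
meet : ∀ {p} {G : Digraph p} {w b} (F : Fragment G w) (F′ : Fragment G b) →
  Fragment.In F b → ¬ Fragment.In F′ w → (∃ λ z → Fragment.In F z × Fragment.In F′ z) → Fragment G b
meet {G = G} {w} {b} F F′ b∈F w∉F′ common = record
  { In        = λ z → F.In z × F′.In z
  ; In?       = λ z → F.In? z ×-dec F′.In? z
  ; cutvertex = λ (_ , b∈F′) → F′.cutvertex b∈F′
  ; inside    = common
  ; outside   = w , (λ (w∈F , _) → F.cutvertex w∈F) , λ { refl → F.cutvertex b∈F }
  ; closed    = λ (x∈F , x∈F′) x→y → case F′.closed x∈F′ x→y of λ
      { (inj₂ y≡b)  → inj₂ y≡b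
      ; (inj₁ y∈F′) → case F.closed x∈F x→y of λ
          { (inj₁ y∈F) → inj₁ (y∈F , y∈F′) ; (inj₂ refl) → ⊥-elim (w∉F′ y∈F′) } }
  }
  where
  module F  = Fragment F
  module F′ = Fragment F′

-- Each cut vertex lies in the other fragment, so no arc leaves the union; by connectivity the union
-- is everything.
complementary : ∀ {p} {G : Digraph p} → Connected G → ∀ {w b} (F : Fragment G w) (F′ : Fragment G b) →
  Fragment.In F b → Fragment.In F′ w → ∀ {v} → ¬ Fragment.In F′ v → Fragment.In F v
complementary {G = G} conn {w} {b} F F′ b∈F w∈F′ {v} v∉F′ = decidable-stable (F.In? v) λ v∉F →
  case conn (λ z → F.In? z ⊎-dec F′.In? z) (inj₁ b∈F) [ v∉F , v∉F′ ]′ of λ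
    { (s , t , inj₁ s∈F , t∉ , s→t)  → [ t∉ ∘ inj₁ , (λ { refl → t∉ (inj₂ w∈F′) }) ]′ (F.closed s∈F s→t)
    ; (s , t , inj₂ s∈F′ , t∉ , s→t) → [ t∉ ∘ inj₂ , (λ { refl → t∉ (inj₁ b∈F) }) ]′ (F′.closed s∈F′ s→t) }
  where
  module F  = Fragment F
  module F′ = Fragment F′

-- Induction on a list containing the fragment. A lone vertex `b` has its only out-arc to `w`.
-- Otherwise the fragment `F′` at `b` yields a smaller fragment within `F`, avoiding `b`: the far
-- side of `F′` if `w` is in `F′`, and else the intersection, which is nonempty by
-- `no-disjoint-fragments`.
fragment-low-within : ∀ {p} n (G : Digraph p) → Critical G → ∀ {w} (F : Fragment G w) xs → length xs ≤ n →
  (∀ {v} → Fragment.In F v → v ∈ xs) → ∃ λ l → Fragment.In F l × Low G l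
fragment-low-within n G crit {w} F xs bound F⊆xs with Fragment.inside F
... | b , b∈F with any? (λ y → Fragment.In? F y ×-dec ¬? (y ≟ b)) | ∈-∃++ (F⊆xs b∈F)
...   | no alone | _ = b , b∈F , inj₁ (w , b→w , only)
  where
  open Fragment F
  only : ∀ {y} → Arc G b y → y ≡ w
  only b→y with closed b∈F b→y
  ... | inj₂ y≡w = y≡w
  ... | inj₁ y∈F = ⊥-elim (alone (_ , y∈F , λ { refl → no-loop G b→y }))
  b→w : Arc G b w
  b→w with out-neighbour {G = G} (Critical.connected crit) {v = w} (λ { refl → cutvertex b∈F })
  ... | t , _ , b→t = subst (Arc G b) (only b→t) b→t
fragment-low-within {p} zero    G crit F xs bound F⊆xs | b , b∈F | yes _ | as , bs , refl =
  ⊥-elim (<⇒≱ (subst (0 <_) (sym (↭-length (shift b as bs))) (s≤s z≤n)) bound)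
fragment-low-within {p} (suc n) G crit {w} F xs bound F⊆xs | b , b∈F | yes (y , y∈F , y≢b) | as , bs , refl
  with Fragment.In? (Critical.fragment crit b) w
... | yes w∈F′ with fragment-low-within n (opposite G) (opposite-Critical crit) (dual F′) (as ++ bs) short
    (λ (v∉F′ , v≢b) → ∈-remove as (F⊆xs (complementary (Critical.connected crit) F F′ b∈F w∈F′ v∉F′)) v≢b)
  where
  F′ = Critical.fragment crit b
  short : length (as ++ bs) ≤ n
  short = ≤-pred (subst (_≤ suc n) (↭-length (shift b as bs)) bound)
...   | l , (l∉F′ , _) , low =
        l , complementary (Critical.connected crit) F (Critical.fragment crit b) b∈F w∈F′ l∉F′ , ⊎-swap low
fragment-low-within {p} (suc n) G crit {w} F xs bound F⊆xs | b , b∈F | yes (y , y∈F , y≢b) | as , bs , refl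
    | no w∉F′ with any? (λ z → Fragment.In? F z ×-dec Fragment.In? (Critical.fragment crit b) z)
... | no apart = ⊥-elim (no-disjoint-fragments (Critical.degrees crit) F (Critical.fragment crit b)
        (Critical.one-way crit b) b∈F w∉F′ (λ z∈F z∈F′ → apart (_ , z∈F , z∈F′)) y∈F y≢b)
... | yes common with fragment-low-within n G crit (meet F (Critical.fragment crit b) b∈F w∉F′ common) (as ++ bs)
    (≤-pred (subst (_≤ suc n) (↭-length (shift b as bs)) bound))
    (λ (v∈F , v∈F′) → ∈-remove as (F⊆xs v∈F) λ { refl → Fragment.cutvertex (Critical.fragment crit b) v∈F′ })
...   | l , (l∈F , _) , low = l , l∈F , low

fragment-low : ∀ {p} {G : Digraph p} → Critical G → ∀ {w} (F : Fragment G w) → ∃ λ l → Fragment.In F l × Low G l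
fragment-low {p} {G} crit F =
  fragment-low-within (length (allFin p)) G crit F (allFin p) ≤-refl λ {v} _ → ∈-allFin v

beyond-low : ∀ {p} {G : Digraph p} → Critical G → ∀ {w} (F : Fragment G w) →
  ∃ λ l → (¬ Fragment.In F l × l ≢ w) × Low G l
beyond-low crit F with fragment-low (opposite-Critical crit) (dual F)
... | l , l∉F , low = l , l∉F , ⊎-swap low

-- The low triangle and the contradiction

outsider : ∀ {p} (xs : List (Fin p)) → length xs < p → ∃ λ v → v ∉ xs
outsider {p} xs short with any? (λ v → ¬? (v ∈? xs))
... | yes found = found
... | no none   = ⊥-elim (<⇒≱ short (subst (_≤ length xs) (length-allFin p)
        (Unique-⊆-length (allFin⁺ p) λ {v} _ → decidable-stable (v ∈? xs) λ v∉ → none (v , v∉))))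

-- No arc leaves the listed vertices, yet with at least four vertices there is one outside.
no-closed-triangle : ∀ {p} (G : Digraph p) → 4 ≤ p → Connected G → ∀ {a b c} →
  (∀ {z} → Arc G a z → z ≡ b) → (∀ {z} → Arc G b z → z ≡ c) → (∀ {z} → Arc G c z → z ≡ a) → ⊥
no-closed-triangle G 4≤p conn {a} {b} {c} a-out b-out c-out
  with outsider (a ∷ b ∷ c ∷ []) 4≤p
... | v , v∉ with conn (_∈? (a ∷ b ∷ c ∷ [])) (here refl) v∉
...   | _ , t , here refl , t∉ , a→t                 = t∉ (there (here (a-out a→t)))
...   | _ , t , there (here refl) , t∉ , b→t         = t∉ (there (there (here (b-out b→t))))
...   | _ , t , there (there (here refl)) , t∉ , c→t = t∉ (here (c-out c→t))

module _ {p : ℕ} {G : Digraph p} (4≤p : 4 ≤ p) (crit : Critical G) where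
  open Critical crit

  adjacent : ∀ {l m} → Low G l → Low G m → l ≢ m → Adjacent G l m
  adjacent = low-adjacent G degrees

  no-OutDegreeOne-arc : ∀ {y y′} → OutDegreeOne G y → OutDegreeOne G y′ → Arc G y y′ → ⊥
  no-OutDegreeOne-arc {y} {y′} out-y@(t , _ , only-t) out-y′@(_ , _ , only-y′) y→y′
    with fragment-low crit (fragment y)
  ... | l , l∈F , low-l = triangle low-l
    where
    module F = Fragment (fragment y)

    only-y : ∀ {z} → Arc G y z → z ≡ y′
    only-y y→z = trans (only-t y→z) (sym (only-t y→y′))

    -- Otherwise no arc would leave the fragment together with `y`, whose only out-neighbour is
    -- `y′`.
    y′∉F : ¬ F.In y′
    y′∉F y′∈F = let (b , b∈F) = F.inside ; (a , a∉F , a≢y) = F.outside in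
      case connected (λ z → F.In? z ⊎-dec (z ≟ y)) (inj₁ b∈F) [ a∉F , a≢y ]′ of λ
        { (_ , _ , inj₁ s∈F , t∉ , s→t)  → t∉ (F.closed s∈F s→t)
        ; (_ , _ , inj₂ refl , t∉ , y→t) → t∉ (inj₁ (subst F.In (sym (only-y y→t)) y′∈F)) }

    l≢y : l ≢ y
    l≢y refl = F.cutvertex l∈F

    l≢y′ : l ≢ y′
    l≢y′ refl = y′∉F l∈F

    -- The opposite arc would leave the fragment at a vertex other than `y`.
    y′→l : Arc G y′ l
    y′→l with adjacent low-l (inj₁ out-y′) l≢y′
    ... | inj₂ y′→l = y′→l
    ... | inj₁ l→y′ = ⊥-elim ([ y′∉F , (λ { refl → no-loop G y→y′ }) ]′ (F.closed l∈F l→y′))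

    only-y′′ : ∀ {z} → Arc G y′ z → z ≡ l
    only-y′′ y′→z = trans (only-y′ y′→z) (sym (only-y′ y′→l))

    l→y : Arc G l y
    l→y with adjacent low-l (inj₁ out-y) l≢y
    ... | inj₁ l→y = l→y
    ... | inj₂ y→l = ⊥-elim (l≢y′ (only-y y→l))

    triangle : Low G l → ⊥
    triangle (inj₁ (_ , _ , only-l)) = no-closed-triangle G 4≤p connected only-y only-y′′
                                    (λ l→z → trans (only-l l→z) (sym (only-l l→y)))
    triangle (inj₂ (_ , _ , into-l)) with outsider (y ∷ y′ ∷ l ∷ []) 4≤p
    ... | v , v∉ = split (F′.In? y)
      where
      module F′ = Fragment (fragment v)

      stay : ∀ {s t} → F′.In s → Arc G s t → v ≢ t → F′.In t
      stay s∈ s→t v≢t with F′.closed s∈ s→t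
      ... | inj₁ t∈  = t∈
      ... | inj₂ t≡v = ⊥-elim (v≢t (sym t≡v))

      v≢y : v ≢ y
      v≢y refl = v∉ (here refl)
      v≢y′ : v ≢ y′
      v≢y′ refl = v∉ (there (here refl))
      v≢l : v ≢ l
      v≢l refl = v∉ (there (there (here refl)))

      split : Dec (F′.In y) → ⊥
      -- The whole triangle is in the fragment and `m` is beyond it: `m → l` forces `m = y′`, the
      -- only in-neighbour of `l`, and `l → m` would leave the fragment.
      split (yes y∈) with beyond-low crit (fragment v)
      ... | m , (m∉ , m≢v) , low-m with adjacent low-m low-l (λ { refl → m∉ l∈ })
        where
        l∈ : F′.In l
        l∈ = stay (stay y∈ y→y′ v≢y′) y′→l v≢l
      ...   | inj₁ m→l = m∉ (subst F′.In (trans (into-l y′→l) (sym (into-l m→l))) (stay y∈ y→y′ v≢y′))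
      ...   | inj₂ l→m = m∉ (stay (stay (stay y∈ y→y′ v≢y′) y′→l v≢l) l→m (m≢v ∘ sym))
      -- Now `m` is in the fragment and `y` is not: `m → y` would leave it, and `y → m` forces
      -- `m = y′`, from which the triangle leads back to `y` inside the fragment.
      split (no y∉) with fragment-low crit (fragment v)
      ... | m , m∈ , low-m with adjacent low-m (inj₁ out-y) (λ { refl → y∉ m∈ })
      ...   | inj₁ m→y = y∉ (stay m∈ m→y v≢y)
      ...   | inj₂ y→m = y∉ (stay (stay (subst F′.In (only-y y→m) m∈) y′→l v≢l) l→y v≢y)

  no-two-OutDegreeOne : ∀ {l m} → OutDegreeOne G l → OutDegreeOne G m → l ≢ m → ⊥
  no-two-OutDegreeOne out-l out-m l≢m with adjacent (inj₁ out-l) (inj₁ out-m) l≢m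
  ... | inj₁ l→m = no-OutDegreeOne-arc out-l out-m l→m
  ... | inj₂ m→l = no-OutDegreeOne-arc out-m out-l m→l

-- A low vertex `l` and low vertices on the two sides of the cut at `l` are three in all, so two of
-- them have out-degree one or two have in-degree one.
no-Critical : ∀ {p} {G : Digraph p} → 4 ≤ p → ¬ Critical G
no-Critical {G = G} 4≤p crit with outsider [] (≤-trans (s≤s z≤n) 4≤p)
... | v , _ with fragment-low crit (Critical.fragment crit v)
...   | l , _ , low-l with fragment-low crit (Critical.fragment crit l) | beyond-low crit (Critical.fragment crit l)
...     | m , m∈ , low-m | n , (n∉ , n≢l) , low-n = pigeonhole low-l low-m low-n
  where
  l≢m : l ≢ m
  l≢m refl = Fragment.cutvertex (Critical.fragment crit l) m∈

  m≢n : m ≢ n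
  m≢n refl = n∉ m∈

  outs : ∀ {a b} → OutDegreeOne G a → OutDegreeOne G b → a ≢ b → ⊥
  outs = no-two-OutDegreeOne 4≤p crit

  ins : ∀ {a b} → OutDegreeOne (opposite G) a → OutDegreeOne (opposite G) b → a ≢ b → ⊥
  ins = no-two-OutDegreeOne 4≤p (opposite-Critical crit)

  pigeonhole : Low G l → Low G m → Low G n → ⊥
  pigeonhole (inj₁ a) (inj₁ b) _        = outs a b l≢m
  pigeonhole (inj₁ a) (inj₂ _) (inj₁ c) = outs a c (n≢l ∘ sym)
  pigeonhole (inj₁ _) (inj₂ b) (inj₂ c) = ins b c m≢n
  pigeonhole (inj₂ a) (inj₂ b) _        = ins a b l≢m
  pigeonhole (inj₂ a) (inj₁ _) (inj₂ c) = ins a c (n≢l ∘ sym)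
  pigeonhole (inj₂ _) (inj₁ b) (inj₁ c) = outs b c m≢n

connected-reversal : ∀ {p} {G : Digraph p} → 4 ≤ p → Connected G → Meyniel G → ∃ λ w → ¬ ∃ (ClosedSubset (reverse-at G w))
connected-reversal {p} {G} 4≤p conn mey with any? (λ w → ¬? (closedSubset? (reverse-at G w)))
... | yes found = found
... | no none   = ⊥-elim (no-Critical 4≤p record
  { connected = conn ; degrees = mey ; fragment = proj₁ ∘ cut ; one-way = proj₂ ∘ cut })
  where
  cut : ∀ w → Σ (Fragment G w) OneWay
  cut w with outsider [ w ] (≤-trans (s≤s (s≤s z≤n)) 4≤p)
  ... | v , v∉ = closed⇒fragment conn (λ v≡w → v∉ (here v≡w))
    (decidable-stable (closedSubset? (reverse-at G w)) λ open-w → none (w , open-w))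

-- From a Hamiltonian cycle to the two paths

crossing : ∀ {A : Set} {P : Pred A 0ℓ} → Decidable P → ∀ k (f : Fin (suc k) → A) →
  P (f zero) → ¬ P (f (fromℕ k)) → ∃ λ i → P (f (inject₁ i)) × ¬ P (f (suc i))
crossing P? zero    f Pf ¬Pf = ⊥-elim (¬Pf Pf)
crossing P? (suc k) f Pf ¬Pf with P? (f (suc zero))
... | no ¬P₁ = zero , Pf , ¬P₁
... | yes P₁ = let i , P , ¬P = crossing P? k (f ∘ suc) P₁ ¬Pf in suc i , P , ¬P

StronglyConnected⇒Connected : ∀ {p} {G : Digraph p} → StronglyConnected G → Connected G
StronglyConnected⇒Connected strong {P} P? {x} {y} Px ¬Py with strong x y
... | k , path with crossing P? k (vtx path) (subst P (sym (start path)) Px) (¬Py ∘ subst P (end path))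
...   | i , Ps , ¬Pt = _ , _ , Ps , ¬Pt , arcs path i

module _ {p : ℕ} {G : Digraph p} where

  walk-head : ∀ {a x T b} → Walk G a (x ∷ T) b → x ≡ a
  walk-head (stop _) = refl
  walk-head (_ ∷ _)  = refl

  walk-last : ∀ {a x T b} → Walk G a (x ∷ T) b → lookup (x ∷ T) (fromℕ (length T)) ≡ b
  walk-last (stop _)            = refl
  walk-last (_ ∷ w@(stop _))    = walk-last w
  walk-last (_ ∷ w@(_ ∷ _))     = walk-last w

  walk-arcs : ∀ {a x T b} → Walk G a (x ∷ T) b → ∀ (i : Fin (length T)) →
    Arc G (lookup (x ∷ T) (inject₁ i)) (lookup (x ∷ T) (suc i))
  walk-arcs (e ∷ w@(stop _)) zero    = e
  walk-arcs (e ∷ w@(_ ∷ _))  zero    = e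
  walk-arcs (e ∷ w@(_ ∷ _))  (suc i) = walk-arcs w i

  walk⇒path : ∀ {a x T b} → Walk G a (x ∷ T) b → Unique (x ∷ T) → Path G (length T) a b
  walk⇒path {x = x} {T} w u = record
    { vtx      = lookup (x ∷ T)
    ; distinct = lookup-injective u
    ; start    = walk-head w
    ; end      = walk-last w
    ; arcs     = walk-arcs w
    }

  walk-end∈ : ∀ {a S b} → Walk G a S b → b ∈ S
  walk-end∈ (stop _) = here refl
  walk-end∈ (_ ∷ w)  = there (walk-end∈ w)

reverse-walk : ∀ {p} {G : Digraph p} {w a S b} → w ∉ S → Walk (reverse-at G w) a S b → Walk G a S b
reverse-walk w∉ (stop a) = stop a
reverse-walk {G = G} {w} w∉ (_∷_ {a} {b} {S} a→b r) =
  trans (sym (reverse-away G w (λ { refl → w∉ (here refl) }) (λ { refl → w∉ (there (walk-start∈ r)) }))) a→b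
  ∷ reverse-walk (w∉ ∘ there) r
  where
  walk-start∈ : ∀ {H a S b} → Walk H a S b → a ∈ S
  walk-start∈ (stop _) = here refl
  walk-start∈ (_ ∷ _)  = here refl

theorem1p19 : (p : ℕ) → 4 ≤ p → (G : Digraph p) → StronglyConnected G →
    (∀ (x y : Fin p) → x ≢ y → ¬ Adjacent G x y → 2 * p ∸ 1 ≤ deg G x + deg G y) →
    ∃ λ (u : Fin p) → ∃ λ (w : Fin p) → ∃ λ (v : Fin p) →
    u ≢ w × w ≢ v × u ≢ v × Arc G u w × Arc G w v ×
    Σ (Path G (p ∸ 2) u v) λ P →
    ¬ OnPath P w × (∀ (z : Fin p) → z ≢ w → OnPath P z)
theorem1p19 p 4≤p G strong mey
  with connected-reversal {G = G} 4≤p (StronglyConnected⇒Connected strong) mey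
... | w , none with outsider [ w ] (≤-trans (s≤s (s≤s z≤n)) 4≤p)
...   | t , t∉ with meyniel (reverse-at G w) (reverse-Meyniel G w mey)
                    (no-closedSubset⇒Connected (reverse-at G w) none) (λ t≡w → t∉ (here t≡w)) w
...     | [] , w→w , _ = ⊥-elim (no-loop (reverse-at G w) w→w)
-- The Hamiltonian cycle of the reversal is read from `w` as `w → u ⇝ v → w`; its two arcs at `w`
-- become `u → w → v` in `G`, and the stretch from `u` to `v` avoids `w` and is unchanged.
...     | u ∷ T , (w→u , rest) , unique@(_ ∷ unique-T) , covers with chain⇒walk (reverse-at G w) T rest
...       | v , r , v→w =
  u , w , v , u≢w , w≢v , u≢v
  , trans (sym (reverse-out G w u)) w→u
  , trans (sym (reverse-in G w v)) v→w
  , subst (λ k → Σ (Path G k u v) λ P → ¬ OnPath P w × (∀ z → z ≢ w → OnPath P z)) length-T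
      ( walk⇒path r′ unique-T
      , (λ (i , eq) → w∉ (subst (_∈ u ∷ T) eq (∈-lookup i)))
      , λ z z≢w → case covers z of λ
          { (here z≡w) → ⊥-elim (z≢w z≡w) ; (there z∈) → index z∈ , sym (lookup-index z∈) } )
  where
  w∉ : w ∉ u ∷ T
  w∉ = Unique-∉ unique

  r′ : Walk G u (u ∷ T) v
  r′ = reverse-walk w∉ r

  u≢w : u ≢ w
  u≢w refl = w∉ (here refl)

  w≢v : w ≢ v
  w≢v refl = w∉ (walk-end∈ r)

  order : p ≡ length (w ∷ u ∷ T)
  order = ≤-antisym
    (subst (_≤ length (w ∷ u ∷ T)) (length-allFin p) (Unique-⊆-length (allFin⁺ p) λ {z} _ → covers z))
    (Unique-length unique)

  length-T : length T ≡ p ∸ 2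
  length-T = cong (_∸ 2) (sym order)

  end≢start : ∀ {a S b} → Walk G a (a ∷ S) b → Unique (a ∷ S) → 1 ≤ length S → a ≢ b
  end≢start (_ ∷ q) (a≢ ∷ _) _ refl = All.lookup a≢ (walk-end∈ q) refl

  u≢v : u ≢ v
  -- From `p ≥ 3` the path has at least one arc, so its ends differ.
  u≢v = end≢start r′ unique-T (subst (1 ≤_) (sym length-T) (∸-monoˡ-≤ 2 (≤-trans (s≤s (s≤s (s≤s z≤n))) 4≤p)))
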